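{- There exist a nonrecursive set $A\le_T\emptyset'$, a family $\{B_q\}_{q\in\mathbb Q\cap(1,2)}$ of subsets of $\mathbb N$, and a family $\{W_n\}_{n\in\mathbb N}$ of subsets of $\mathbb N$ such that (i) $B_q\equiv_{\rm bfo}A$ for every $q\in\mathbb Q\cap(1,2)$; (ii) $W_n\equiv_{\rm bfo}A$ for every $n\in\mathbb N$; (iii) $B_p<_1 B_q$ whenever $p,q\in\mathbb Q\cap(1,2)$ and $p<q$; (iv) $W_n\not\le_1 W_m$ whenever $n\ne m$. Consequently, the bounded finite-one degree of $A$ contains both a copy of $(\mathbb Q,\le)$ and an infinite antichain of $1$-degrees.
   Context: All sets are subsets of $\mathbb N=\{0,1,\dots\}$; $\emptyset'$ is the Turing jump of the empty set; nonrecursive means not computable. For $A,B\subseteq\mathbb N$: $A\le_1 B$ means there is a total computable injective $f:\mathbb N\to\mathbb N$ with $x\in A\iff f(x)\in B$ for all $x$. $A\le_{\rm bfo}B$ means there are a total computable $f:\mathbb N\to\mathbb N$ and a constant $c\ge1$ with $x\in A\iff f(x)\in B$ for all $x$ and $|f^{ -1}(y)|\le c$ for all $y$. For $r\in\{1,{\rm bfo}\}$, $A\equiv_r B$ means $A\le_r B$ and $B\le_r A$; $A<_r B$ means $A\le_r B$ and $B\not\le_r A$. The equivalence classes of $\equiv_1$ are the $1$-degrees, those of $\equiv_{\rm bfo}$ the bounded finite-one degrees. Since $\le_1$ implies $\le_{\rm bfo}$, each bounded finite-one degree is a union of $1$-degrees; these are partially ordered by $\deg_1(X)\le\deg_1(Y)\iff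 X\le_1 Y$. "Contains a copy of" a partial order means that there is an order-embedding (preserving and reflecting $\le$) of it into this poset of $1$-degrees. -}

module Defs where

open import Data.Fin.Base using (Fin; toℕ)
open import Data.Fin.Properties using (toℕ-injective)
open import Data.Nat.Base using (ℕ; zero; suc; _+_; _≤_; _<_; s≤s; z≤n)
open import Data.Nat.Properties
  using (+-mono-≤; +-monoʳ-≤; m≤n+m; m≤m+n; n<1+n; +-comm; <-cmp; <⇒≢; +-cancelˡ-≡;
         +-cancelʳ-≡; suc-injective; module ≤-Reasoning)
open import Data.Product.Base using (∃; _×_; _,_; proj₁; proj₂; swap)
open import Data.Rational.Base as ℚ using (ℚ; 1ℚ)
import Data.Rational.Properties as ℚ
open import Data.Sum.Base using (_⊎_)
open import Data.Vec.Base using (Vec; []; _∷_; [_]; lookup)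
open import Data.Vec.Relation.Binary.Pointwise.Inductive using (Pointwise; []; _∷_)
open import Function.Base using (id; _∘_)
open import Function.Bundles using (_⇔_; _↣_)
open import Function.Definitions using (Injective)
import Function.Construct.Composition as Comp
import Function.Construct.Identity as Id
open import Level using (0ℓ) renaming (suc to lsuc; _⊔_ to _⊔ˡ_)
open import Relation.Binary.Bundles using (Poset; DecTotalOrder)
open import Relation.Binary.Definitions using (tri<; tri≈; tri>)
open import Relation.Binary.Morphism.Structures using (IsOrderMonomorphism)
open import Relation.Binary.PropositionalEquality
  using (_≡_; _≢_; refl; sym; trans; cong; cong₂)
open import Relation.Nullary.Negation.Core using (¬_; contradiction)
open import Relation.Unary using (Pred; _∈_; _∉_; ∅)

-- Programs for Kleene's μ-recursive functions relative to an oracle, indexed by arity.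
data Code : ℕ → Set where
  zer    : Code 0
  succ   : Code 1
  proj   : ∀ {n} → Fin n → Code n
  comp   : ∀ {m n} → Code m → Vec (Code n) m → Code n
  prec   : ∀ {n} → Code n → Code (suc (suc n)) → Code (suc n)
  mu     : ∀ {n} → Code (suc n) → Code n
  oracle : Code 1

-- The graph of the characteristic function of A.
χ : Pred ℕ 0ℓ → ℕ → ℕ → Set
χ A x b = (x ∈ A × b ≡ 1) ⊎ (x ∉ A × b ≡ 0)

-- O ⊢ c · xs ↓ y: with oracle O, the program c on input xs halts with output y.
infix 4 _⊢_·_↓_

data _⊢_·_↓_ (O : Pred ℕ 0ℓ) : ∀ {n} → Code n → Vec ℕ n → ℕ → Set where
  zer    : O ⊢ zer · [] ↓ 0
  succ   : ∀ {x} → O ⊢ succ · [ x ] ↓ suc x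
  proj   : ∀ {n} {i : Fin n} {xs} → O ⊢ proj i · xs ↓ lookup xs i
  comp   : ∀ {m n} {f : Code m} {gs : Vec (Code n) m} {xs ys z} →
           Pointwise (λ g y → O ⊢ g · xs ↓ y) gs ys →
           O ⊢ f · ys ↓ z →
           O ⊢ comp f gs · xs ↓ z
  prec₀  : ∀ {n} {f : Code n} {g xs y} →
           O ⊢ f · xs ↓ y →
           O ⊢ prec f g · 0 ∷ xs ↓ y
  precₛ  : ∀ {n} {f : Code n} {g xs k y z} →
           O ⊢ prec f g · k ∷ xs ↓ y →
           O ⊢ g · k ∷ y ∷ xs ↓ z →
           O ⊢ prec f g · suc k ∷ xs ↓ z
  mu     : ∀ {n} {f : Code (suc n)} {xs k} →
           (∀ {j} → j < k → ∃ λ y → O ⊢ f · j ∷ xs ↓ suc y) →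
           O ⊢ f · k ∷ xs ↓ 0 →
           O ⊢ mu f · xs ↓ k
  oracle : ∀ {x b} → χ O x b → O ⊢ oracle · [ x ] ↓ b

-- pair is Cantor's pairing function; encode is the Gödel numbering of programs. It does
-- not record arities, and is injective on the programs of each fixed arity.
triangle : ℕ → ℕ
triangle zero    = 0
triangle (suc n) = suc n + triangle n

pair : ℕ → ℕ → ℕ
pair x y = triangle (x + y) + y

tag : ∀ {n} → Code n → ℕ
tag zer        = 0
tag succ       = 1
tag (proj _)   = 2
tag (comp _ _) = 3
tag (prec _ _) = 4
tag (mu _)     = 5
tag oracle     = 6

encode  : ∀ {n} → Code n → ℕ
payload : ∀ {n} → Code n → ℕ
encodes : ∀ {m n} → Vec (Code n) m → ℕ

encode c = pair (tag c) (payload c)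

payload zer         = 0
payload succ        = 0
payload (proj i)    = toℕ i
payload (comp f gs) = pair (encode f) (encodes gs)
payload (prec f g)  = pair (encode f) (encode g)
payload (mu f)      = encode f
payload oracle      = 0

encodes []       = 0
encodes (g ∷ gs) = suc (pair (encode g) (encodes gs))

triangle-mono : ∀ {m n} → m ≤ n → triangle m ≤ triangle n
triangle-mono z≤n       = z≤n
triangle-mono (s≤s m≤n) = +-mono-≤ (s≤s m≤n) (triangle-mono m≤n)

pair-< : ∀ x y x′ y′ → x + y < x′ + y′ → pair x y < pair x′ y′
pair-< x y x′ y′ lt = begin-strict
  triangle (x + y) + y              ≤⟨ +-monoʳ-≤ (triangle (x + y)) (m≤n+m y x) ⟩
  triangle (x + y) + (x + y)        <⟨ n<1+n _ ⟩
  suc (triangle (x + y) + (x + y))  ≡⟨ cong suc (+-comm (triangle (x + y)) (x + y)) ⟩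
  triangle (suc (x + y))            ≤⟨ triangle-mono lt ⟩
  triangle (x′ + y′)                ≤⟨ m≤m+n _ y′ ⟩
  pair x′ y′                        ∎
  where open ≤-Reasoning

pair-injective : ∀ x y x′ y′ → pair x y ≡ pair x′ y′ → x ≡ x′ × y ≡ y′
pair-injective x y x′ y′ eq with <-cmp (x + y) (x′ + y′)
... | tri< lt _ _ = contradiction eq (<⇒≢ (pair-< x y x′ y′ lt))
... | tri> _ _ gt = contradiction (sym eq) (<⇒≢ (pair-< x′ y′ x y gt))
... | tri≈ _ s _  = x≡x′ , y≡y′
  where
  y≡y′ : y ≡ y′
  y≡y′ = +-cancelˡ-≡ (triangle (x + y)) y y′
           (trans eq (cong (λ t → triangle t + y′) (sym s)))
  x≡x′ : x ≡ x′
  x≡x′ = +-cancelʳ-≡ y x x′ (trans s (cong (x′ +_) (sym y≡y′)))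

encode-injective  : ∀ {n} (c d : Code n) → encode c ≡ encode d → c ≡ d
payload-injective : ∀ {n} (c d : Code n) → tag c ≡ tag d → payload c ≡ payload d → c ≡ d
encodes-injective : ∀ {n m m′} (gs : Vec (Code n) m) (hs : Vec (Code n) m′) →
                    encodes gs ≡ encodes hs →
                    _≡_ {A = ∃ (Vec (Code n))} (m , gs) (m′ , hs)

encode-injective c d eq with pair-injective (tag c) (payload c) (tag d) (payload d) eq
... | t , p = payload-injective c d t p

payload-injective zer         zer         refl _  = refl
payload-injective succ        succ        refl _  = refl
payload-injective oracle      oracle      refl _  = refl
payload-injective (proj i)    (proj j)    refl eq = cong proj (toℕ-injective eq)
payload-injective (mu f)      (mu g)      refl eq = cong mu (encode-injective f g eq)
payload-injective (prec f g)  (prec h k)  refl eq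
  with pair-injective (encode f) (encode g) (encode h) (encode k) eq
... | p , q = cong₂ prec (encode-injective f h p) (encode-injective g k q)
payload-injective (comp f gs) (comp h hs) refl eq
  with pair-injective (encode f) (encodes gs) (encode h) (encodes hs) eq
... | p , q with encodes-injective gs hs q
...   | refl = cong (λ f → comp f gs) (encode-injective f h p)

encodes-injective []       []       _  = refl
encodes-injective (g ∷ gs) (h ∷ hs) eq
  with pair-injective (encode g) (encodes gs) (encode h) (encodes hs) (suc-injective eq)
... | p , q with encode-injective g h p | encodes-injective gs hs q
...   | refl | refl = refl

-- The Turing jump {e : φₑ^X(e)↓}; numbers which are not of the form encode c index
-- the nowhere defined function.
_′ : Pred ℕ 0ℓ → Pred ℕ 0ℓ
(X ′) e = ∃ λ (c : Code 1) → encode c ≡ e × ∃ λ y → X ⊢ c · [ e ] ↓ y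

∅′ : Pred ℕ 0ℓ
∅′ = ∅ ′

infix 4 _≤T_ _≤₁_ _≡₁_ _<₁_ _≤bfo_ _≡bfo_

_≤T_ : Pred ℕ 0ℓ → Pred ℕ 0ℓ → Set
A ≤T B = ∃ λ (c : Code 1) → ∀ x b → χ A x b → B ⊢ c · [ x ] ↓ b

Recursive : Pred ℕ 0ℓ → Set
Recursive A = A ≤T ∅

Computable : (ℕ → ℕ) → Set
Computable f = ∃ λ (c : Code 1) → ∀ x → ∅ ⊢ c · [ x ] ↓ f x

Reduces : (ℕ → ℕ) → Pred ℕ 0ℓ → Pred ℕ 0ℓ → Set
Reduces f A B = ∀ x → x ∈ A ⇔ f x ∈ B

_≤₁_ : Pred ℕ 0ℓ → Pred ℕ 0ℓ → Set
A ≤₁ B = ∃ λ f → Computable f × Injective _≡_ _≡_ f × Reduces f A B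

_≡₁_ : Pred ℕ 0ℓ → Pred ℕ 0ℓ → Set
A ≡₁ B = A ≤₁ B × B ≤₁ A

_<₁_ : Pred ℕ 0ℓ → Pred ℕ 0ℓ → Set
A <₁ B = A ≤₁ B × ¬ (B ≤₁ A)

-- |f⁻¹(y)| ≤ c is rendered as: the fibre of f over y injects into Fin c.
_≤bfo_ : Pred ℕ 0ℓ → Pred ℕ 0ℓ → Set
A ≤bfo B = ∃ λ f → ∃ λ c → Computable f × 1 ≤ c × Reduces f A B ×
           (∀ y → (∃ λ x → f x ≡ y) ↣ Fin c)

_≡bfo_ : Pred ℕ 0ℓ → Pred ℕ 0ℓ → Set
A ≡bfo B = A ≤bfo B × B ≤bfo A

≤₁-refl : ∀ A → A ≤₁ A
≤₁-refl A = id , (proj Fin.zero , λ _ → proj) , id , λ _ → Id.⇔-id _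

≤₁-trans : ∀ A B C → A ≤₁ B → B ≤₁ C → A ≤₁ C
≤₁-trans A B C (f , (c , cf) , f-inj , rf) (g , (d , dg) , g-inj , rg) =
  g ∘ f , (comp d [ c ] , λ x → comp (cf x ∷ []) (dg (f x))) , f-inj ∘ g-inj ,
  λ x → Comp._⇔-∘_ (rg (f x)) (rf x)

-- The 1-degrees contained in the bounded finite-one degree of A. A degree is given
-- by a representative, and equality of degrees is ≡₁.
1-degreesIn : Pred ℕ 0ℓ → Poset (lsuc 0ℓ) 0ℓ 0ℓ
1-degreesIn A = record
  { Carrier        = ∃ λ X → X ≡bfo A
  ; _≈_            = λ X Y → proj₁ X ≡₁ proj₁ Y
  ; _≤_            = λ X Y → proj₁ X ≤₁ proj₁ Y
  ; isPartialOrder = record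
    { isPreorder = record
      { isEquivalence = record
        { refl  = λ {X} → ≤₁-refl (proj₁ X) , ≤₁-refl (proj₁ X)
        ; sym   = swap
        ; trans = λ {X} {Y} {Z} (p , p′) (q , q′) →
                    ≤₁-trans (proj₁ X) (proj₁ Y) (proj₁ Z) p q ,
                    ≤₁-trans (proj₁ Z) (proj₁ Y) (proj₁ X) q′ p′
        }
      ; reflexive = proj₁
      ; trans     = λ {X} {Y} {Z} → ≤₁-trans (proj₁ X) (proj₁ Y) (proj₁ Z)
      }
    ; antisym = _,_
    }
  }

ContainsCopyOf : ∀ {a b c d e f} → Poset a b c → Poset d e f →
                 Set (a ⊔ˡ b ⊔ˡ c ⊔ˡ d ⊔ˡ e ⊔ˡ f)
ContainsCopyOf P Q = ∃ λ (h : Q.Carrier → P.Carrier) →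
                     IsOrderMonomorphism Q._≈_ P._≈_ Q._≤_ P._≤_ h
  where
  module P = Poset P
  module Q = Poset Q

-- Distinctness of the elements h n follows from incomparability and reflexivity.
HasInfiniteAntichain : ∀ {a b c} → Poset a b c → Set (a ⊔ˡ c)
HasInfiniteAntichain P = ∃ λ (h : ℕ → P.Carrier) →
                         ∀ {m n} → m ≢ n → ¬ (h m P.≤ h n) × ¬ (h n P.≤ h m)
  where
  module P = Poset P

ℚ-poset : Poset 0ℓ 0ℓ 0ℓ
ℚ-poset = DecTotalOrder.poset ℚ.≤-decTotalOrder

2ℚ : ℚ
2ℚ = 1ℚ ℚ.+ 1ℚ

ℚ∩⟨1,2⟩ : Set
ℚ∩⟨1,2⟩ = ∃ λ q → 1ℚ ℚ.< q × q ℚ.< 2ℚ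

module Submission where

-- Let A consist of the last elements of consecutive blocks, the e-th block being [ℓ , ℓ + φₑ(ℓ)]
-- (or [ℓ , ℓ] if φₑ(ℓ) is undefined), where ℓ is its first element. Then A ≤T ∅′, and A is generic:
-- if g and h are computable and, for every ℓ, differ at some y with both values at least ℓ, then
-- g y ∈ A ⇔ h y ∈ A fails for some y, because φₑ may search for such a y and end its block at the
-- larger of the two values.
--
-- Given a decidable set D, double the elements of D, that is, let B be the preimage of A under the
-- monotone surjection whose fibre over n has two elements if n ∈ D and one otherwise. By
-- genericity, an injective reduction has to preserve almost all of these fibres, so doubling D
-- does not reduce to doubling E when D ∖ E is infinite, while it does when D ⊆ E. The sets
-- D = {n : r n < q} for a sequence r taking every rational value infinitely often yield the chain,
-- and infinitely many disjoint infinite sets the antichain.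

open import Axiom.ExcludedMiddle using (ExcludedMiddle)
open import Data.Empty using (⊥)
open import Data.Fin.Base using (Fin; toℕ; fromℕ<)
open import Data.Fin.Patterns using (0F; 1F; 2F)
open import Data.Fin.Properties using (any?; fromℕ<-injective; pigeonhole)
open import Data.Integer.Base as ℤ using (ℤ; +_; -[1+_])
import Data.Integer.Properties as ℤ
open import Data.Nat.Base
open import Data.Nat.Properties
open import Data.Nat.Tactic.RingSolver using (solve-∀)
open import Data.Product.Base using (∃; _×_; _,_; proj₁; proj₂)
open import Data.Rational.Base as ℚ using (ℚ; ↥_; ↧_; ↧ₙ_)
import Data.Rational.Properties as ℚ
open import Data.Sum.Base using (inj₁; inj₂)
open import Data.Vec.Base using (Vec; []; _∷_; [_]; lookup; head; tail)
open import Data.Vec.Relation.Binary.Pointwise.Inductive using (Pointwise; []; _∷_)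
open import Function.Base using (_∘_)
open import Function.Bundles using (_⇔_; mk⇔; mk↣; module Equivalence)
open import Function.Construct.Identity using (⇔-id)
open import Function.Definitions using (Injective)
open import Level using (0ℓ)
open import Relation.Binary.Definitions using (tri<; tri≈; tri>)
open import Relation.Binary.PropositionalEquality hiding ([_])
open import Relation.Nullary.Decidable.Core using (Dec; yes; no)
open import Relation.Nullary.Negation.Core using (¬_; contradiction)
open import Relation.Unary using (Pred; _∈_; _∉_; ∅)
open import Defs

private variable
  m n : ℕ
  O : Pred ℕ 0ℓ

-- Least zeros of functions on the natural numbers.

leastZero : (f : ℕ → ℕ) → ∃ (λ k → f k ≡ 0) → ∃ λ k → f k ≡ 0 × (∀ {j} → j < k → f j ≢ 0)
leastZero f (zero  , f0≡0) = 0 , f0≡0 , λ ()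
leastZero f (suc k , fk≡0) with f 0 ≟ 0 | leastZero (f ∘ suc) (k , fk≡0)
... | yes f0≡0 | _              = 0 , f0≡0 , λ ()
... | no  f0≢0 | l , fl≡0 , min = suc l , fl≡0 , λ { {zero} _ → f0≢0 ; {suc _} (s≤s j<l) → min j<l }

opaque
  μ : (f : ℕ → ℕ) → ∃ (λ k → f k ≡ 0) → ℕ
  μ f z = proj₁ (leastZero f z)

  μ-zero : ∀ (f : ℕ → ℕ) (z : ∃ λ k → f k ≡ 0) → f (μ f z) ≡ 0
  μ-zero f z = proj₁ (proj₂ (leastZero f z))

  μ-least : ∀ (f : ℕ → ℕ) (z : ∃ λ k → f k ≡ 0) {j} → j < μ f z → f j ≢ 0
  μ-least f z = proj₂ (proj₂ (leastZero f z))

-- Programs of computable functions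

-- Bundling a program with its correctness lets each combinator below build both at once.
record Program (O : Pred ℕ 0ℓ) {n : ℕ} (f : Vec ℕ n → ℕ) : Set where
  constructor program
  field
    code  : Code n
    halts : ∀ xs → O ⊢ code · xs ↓ f xs

open Program

infixl 5 _by_

Program₁ : Pred ℕ 0ℓ → (ℕ → ℕ) → Set
Program₁ O f = Program O {1} (f ∘ head)

fromComputable : ∀ {f} → Computable f → Program₁ ∅ f
fromComputable (c , h) = program c λ { (x ∷ []) → h x }

toComputable : ∀ {f} → Program₁ ∅ f → Computable f
toComputable p = code p , λ x → halts p [ x ]

arg : (i : Fin n) → Program O (λ xs → lookup xs i)
arg i = program (proj i) λ _ → proj

app₁ : {f : Vec ℕ 1 → ℕ} {g : Vec ℕ n → ℕ} →
       Program O f → Program O g → Program O (λ xs → f [ g xs ])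
app₁ p q = program (comp (code p) [ code q ]) λ xs →
  comp (halts q xs ∷ []) (halts p _)

app₂ : {f : Vec ℕ 2 → ℕ} {g h : Vec ℕ n → ℕ} →
       Program O f → Program O g → Program O h → Program O (λ xs → f (g xs ∷ h xs ∷ []))
app₂ p q r = program (comp (code p) (code q ∷ code r ∷ [])) λ xs →
  comp (halts q xs ∷ halts r xs ∷ []) (halts p _)

_by_ : {f g : Vec ℕ n → ℕ} → Program O f → (∀ xs → f xs ≡ g xs) → Program O g
p by f≗g = program (code p) λ xs → subst (_ ⊢ _ · xs ↓_) (f≗g xs) (halts p xs)

argument : Program₁ O (λ x → x)
argument = arg 0F by λ { (x ∷ []) → refl }

primrec : {f : Vec ℕ n → ℕ} {g : Vec ℕ (2 + n) → ℕ} (F : ℕ → Vec ℕ n → ℕ) →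
          Program O f → Program O g →
          (∀ xs → f xs ≡ F 0 xs) → (∀ k xs → g (k ∷ F k xs ∷ xs) ≡ F (suc k) xs) →
          Program O (λ xs → F (head xs) (tail xs))
primrec {O = O} F p q base step = program (prec (code p) (code q)) λ { (k ∷ xs) → go k xs }
  where
  go : ∀ k xs → O ⊢ prec (code p) (code q) · k ∷ xs ↓ F k xs
  go zero    xs = prec₀ (halts (p by base) xs)
  go (suc k) xs = precₛ (go k xs) (subst (O ⊢ _ · _ ↓_) (step k xs) (halts q _))

minimise : {f : Vec ℕ (suc n) → ℕ} → Program O f → (z : ∀ xs → ∃ λ k → f (k ∷ xs) ≡ 0) →
           Program O (λ xs → μ (λ k → f (k ∷ xs)) (z xs))
minimise {O = O} {f = f} p z = program (mu (code p)) λ xs →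
  mu (λ {j} j<k → pred (f (j ∷ xs)) ,
                  evaluate xs j (sym (suc-pred _ {{≢-nonZero (μ-least _ (z xs) j<k)}})))
     (evaluate xs _ (μ-zero _ (z xs)))
  where
  evaluate : ∀ xs k {y} → f (k ∷ xs) ≡ y → O ⊢ code p · k ∷ xs ↓ y
  evaluate xs k refl = halts p (k ∷ xs)

sucP : {f : Vec ℕ n → ℕ} → Program O f → Program O (λ xs → suc (f xs))
sucP p = program (comp succ [ code p ]) λ xs → comp (halts p xs ∷ []) succ

lit : ∀ k → Program O {n} (λ _ → k)
lit zero    = program (comp zer []) λ _ → comp [] zer
lit (suc k) = sucP (lit k)

infixl 6 _+P_ _∸P_
infixl 7 _*P_

_+P_ : {f g : Vec ℕ n → ℕ} → Program O f → Program O g → Program O (λ xs → f xs + g xs)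
_+P_ = app₂ (primrec (λ k xs → k + head xs) (arg 0F) (sucP (arg 1F))
                     (λ { (x ∷ []) → refl }) (λ _ _ → refl))

_*P_ : {f g : Vec ℕ n → ℕ} → Program O f → Program O g → Program O (λ xs → f xs * g xs)
_*P_ = app₂ (primrec (λ k xs → k * head xs) (lit 0) (arg 2F +P arg 1F)
                     (λ _ → refl) (λ { k (x ∷ []) → refl }))

predP : {f : Vec ℕ n → ℕ} → Program O f → Program O (λ xs → pred (f xs))
predP = app₁ (primrec (λ k _ → pred k) (lit 0) (arg 0F) (λ _ → refl) (λ _ _ → refl))

_∸P_ : {f g : Vec ℕ n → ℕ} → Program O f → Program O g → Program O (λ xs → f xs ∸ g xs)
p ∸P q = app₂ (primrec (λ k xs → head xs ∸ k) (arg 0F) (predP (arg 1F))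
                       (λ { (x ∷ []) → refl }) (λ { k (x ∷ []) → pred[m∸n]≡m∸[1+n] x k }))
              -- The recursion is on the subtrahend, so the arguments are swapped.
              q p

triangleP : {f : Vec ℕ n → ℕ} → Program O f → Program O (λ xs → triangle (f xs))
triangleP = app₁ (primrec (λ k _ → triangle k) (lit 0) (sucP (arg 0F) +P arg 1F)
                          (λ _ → refl) (λ _ _ → refl))

pairP : {f g : Vec ℕ n → ℕ} → Program O f → Program O g → Program O (λ xs → pair (f xs) (g xs))
pairP p q = triangleP (p +P q) +P q

-- Determinism of evaluation.

deterministic  : ∀ {c : Code n} {xs y z} → O ⊢ c · xs ↓ y → O ⊢ c · xs ↓ z → y ≡ z
deterministics : {gs : Vec (Code n) m} {xs : Vec ℕ n} {ys zs : Vec ℕ m} →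
                 Pointwise (λ g y → O ⊢ g · xs ↓ y) gs ys →
                 Pointwise (λ g z → O ⊢ g · xs ↓ z) gs zs → ys ≡ zs

deterministic zer           zer           = refl
deterministic succ          succ          = refl
deterministic proj          proj          = refl
deterministic (comp ps p)   (comp qs q)   with deterministics ps qs
... | refl = deterministic p q
deterministic (prec₀ p)     (prec₀ q)     = deterministic p q
deterministic (precₛ p p′)  (precₛ q q′)  with deterministic p q
... | refl = deterministic p′ q′
deterministic (mu {k = k} ps p) (mu {k = l} qs q) with <-cmp k l
-- The smaller output is a zero of the searched function, where the other run demands a successor.
... | tri< k<l _ _ = contradiction (deterministic p (proj₂ (qs k<l))) λ ()
... | tri≈ _ k≡l _ = k≡l
... | tri> _ _ l<k = contradiction (deterministic q (proj₂ (ps l<k))) λ ()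
deterministic (oracle (inj₁ (_ , refl)))   (oracle (inj₁ (_ , refl)))   = refl
deterministic (oracle (inj₁ (x∈O , _)))    (oracle (inj₂ (x∉O , _)))    = contradiction x∈O x∉O
deterministic (oracle (inj₂ (x∉O , _)))    (oracle (inj₁ (x∈O , _)))    = contradiction x∈O x∉O
deterministic (oracle (inj₂ (_ , refl)))   (oracle (inj₂ (_ , refl)))   = refl

deterministics []       []       = refl
deterministics (p ∷ ps) (q ∷ qs) = cong₂ _∷_ (deterministic p q) (deterministics ps qs)

-- Partitions of ℕ into nonempty consecutive blocks

module Blocks (L : ℕ → ℕ) (L-zero : L 0 ≡ 0) (L-step : ∀ n → L n < L (suc n)) where

  n≤L : ∀ n → n ≤ L n
  n≤L zero    = z≤n
  n≤L (suc n) = ≤-<-trans (n≤L n) (L-step n)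

  L-mono : ∀ {m n} → m ≤ n → L m ≤ L n
  L-mono = go ∘ ≤⇒≤′
    where
    go : ∀ {m n} → m ≤′ n → L m ≤ L n
    go ≤′-refl       = ≤-refl
    go (≤′-step m≤n) = ≤-trans (go m≤n) (<⇒≤ (L-step _))

  -- The difference vanishes exactly when `x < L (suc n)`, so its least zero is the index of the
  -- block containing `x`.
  passed : ∀ x → ∃ λ n → suc x ∸ L (suc n) ≡ 0
  passed x = x , m≤n⇒m∸n≡0 (n≤L (suc x))

  index : ℕ → ℕ
  index x = μ (λ n → suc x ∸ L (suc n)) (passed x)

  offset : ℕ → ℕ
  offset x = x ∸ L (index x)

  index-upper : ∀ x → x < L (suc (index x))
  index-upper x = m∸n≡0⇒m≤n (μ-zero _ (passed x))

  index-lower : ∀ x → L (index x) ≤ x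
  index-lower x with index x in eq
  ... | zero  = subst (_≤ x) (sym L-zero) z≤n
  ... | suc n = ≮⇒≥ λ x<L → μ-least _ (passed x) (≤-reflexive (sym eq)) (m≤n⇒m∸n≡0 x<L)

  index-unique : ∀ {x n} → L n ≤ x → x < L (suc n) → index x ≡ n
  index-unique {x} {n} Ln≤x x<L = ≤-antisym
    (≮⇒≥ λ n<i → <-irrefl refl (<-≤-trans x<L (≤-trans (L-mono n<i) (index-lower x))))
    (≮⇒≥ λ i<n → <-irrefl refl (<-≤-trans (index-upper x) (≤-trans (L-mono i<n) Ln≤x)))

  index-L : ∀ n → index (L n) ≡ n
  index-L n = index-unique ≤-refl (L-step n)

  L-injective : ∀ {m n} → L m ≡ L n → m ≡ n
  L-injective {m} {n} eq = trans (sym (index-L m)) (trans (cong index eq) (index-L n))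

  index-<⇒<L : ∀ {x n} → index x < n → x < L n
  index-<⇒<L {x} i<n = <-≤-trans (index-upper x) (L-mono i<n)

  L+offset : ∀ x → L (index x) + offset x ≡ x
  L+offset x = m+[n∸m]≡n (index-lower x)

  indexP : Program₁ O L → {f : Vec ℕ n → ℕ} → Program O f → Program O (λ xs → index (f xs))
  indexP p = app₁ index₁
    where
    index₁ : Program₁ _ index
    index₁ = minimise (sucP (arg 1F) ∸P app₁ p (sucP (arg 0F))) (λ { (x ∷ []) → passed x })
             by λ { (x ∷ []) → refl }

  offsetP : Program₁ O L → {f : Vec ℕ n → ℕ} → Program O f → Program O (λ xs → offset (f xs))
  offsetP p q = q ∸P app₁ p (indexP p q)

-- The queries put to ∅′

-- The first argument, over which `exceeds` searches, is ignored: with the others `w` and `t`, the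
-- search stops at once if `t < w` and never otherwise.
excess : Program ∅ {3} (λ xs → suc (lookup xs 2F) ∸ lookup xs 1F)
excess = sucP (arg 2F) ∸P arg 1F

-- Opaque, since conversion checking must not evaluate the Gödel number of exceeds.
opaque
  exceeds : Code 2
  exceeds = mu (code excess)

  exceeds-halts : ∀ {w t} → t < w → ∅ ⊢ exceeds · w ∷ t ∷ [] ↓ 0
  exceeds-halts {w} {t} t<w =
    mu (λ ()) (subst (∅ ⊢ code excess · 0 ∷ w ∷ t ∷ [] ↓_) (m≤n⇒m∸n≡0 t<w)
                     (halts excess (0 ∷ w ∷ t ∷ [])))

  exceeds-halts⁻¹ : ∀ {w t k} → ∅ ⊢ exceeds · w ∷ t ∷ [] ↓ k → t < w
  exceeds-halts⁻¹ {w} {t} {k} (mu _ p) =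
    m∸n≡0⇒m≤n (deterministic (halts excess (k ∷ w ∷ t ∷ [])) p)

literal : ℕ → Code 1
literal k = code (lit {O = ∅} {n = 1} k)

literal-↓ : ∀ k x → ∅ ⊢ literal k · [ x ] ↓ k
literal-↓ k x = halts (lit k) [ x ]

-- The input is ignored, because the jump runs each program on its own number.
query : Code 1 → ℕ → ℕ → Code 1
query c ℓ t = comp exceeds (comp c [ literal ℓ ] ∷ literal t ∷ [])

query-halts : ∀ {c ℓ t w x} → ∅ ⊢ c · [ ℓ ] ↓ w → t < w → ∅ ⊢ query c ℓ t · [ x ] ↓ 0
query-halts {ℓ = ℓ} {t} {x = x} p t<w =
  comp (comp (literal-↓ ℓ x ∷ []) p ∷ literal-↓ t x ∷ []) (exceeds-halts t<w)

query-halts⁻¹ : ∀ {c ℓ t x y} → ∅ ⊢ query c ℓ t · [ x ] ↓ y → ∃ λ w → ∅ ⊢ c · [ ℓ ] ↓ w × t < w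
query-halts⁻¹ {c} {ℓ} {t} {x} (comp (comp (i ∷ []) p ∷ j ∷ []) q)
  with refl ← deterministic i (literal-↓ ℓ x)
     | refl ← deterministic j (literal-↓ t x)
  = _ , p , exceeds-halts⁻¹ q

-- The tag 3 belongs to `comp`, and the `suc` excludes an empty list of inner programs. The arity is
-- existential, as the number does not record it.
encode-comp⁻¹ : ∀ (d : Code n) a b b′ → encode d ≡ pair 3 (pair a (suc (pair b b′))) →
                ∃ λ m → ∃ λ (f : Code (suc m)) → ∃ λ (g : Code n) → ∃ λ (gs : Vec (Code n) m) →
                encode f ≡ a × encode g ≡ b × encodes gs ≡ b′
encode-comp⁻¹ d a b b′ eq with pair-injective (tag d) (payload d) 3 (pair a (suc (pair b b′))) eq
encode-comp⁻¹ (comp f []) a b b′ _ | _ , eq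
  with _ , () ← pair-injective (encode f) 0 a (suc (pair b b′)) eq
encode-comp⁻¹ (comp f (g ∷ gs)) a b b′ _ | _ , eq
  with f≡a , eq′ ← pair-injective (encode f) (encodes (g ∷ gs)) a (suc (pair b b′)) eq
  with g≡b , gs≡b′ ← pair-injective (encode g) (encodes gs) b b′ (suc-injective eq′)
  = _ , f , g , gs , f≡a , g≡b , gs≡b′

literalP : {f : Vec ℕ n → ℕ} → Program O f → Program O (λ xs → encode (literal (f xs)))
literalP = app₁ (primrec (λ k _ → encode (literal k))
                         (lit (encode (literal 0)))
                         -- `literal (suc k)` is `comp succ [ literal k ]`.
                         (pairP (lit 3) (pairP (lit (encode succ)) (sucP (pairP (arg 1F) (lit 0)))))
                         (λ _ → refl) (λ _ _ → refl))

-- For e = encode c, this is the number of query c ℓ t, which belongs to ∅′ exactly when φₑ(ℓ) is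
-- defined and exceeds t; hence φₑ(ℓ) is the least t for which it does not.
opaque
  question : ℕ → ℕ → ℕ → ℕ
  question e ℓ t =
    pair 3 (pair (encode exceeds) (suc (pair (pair 3 (pair e (suc (pair (encode (literal ℓ)) 0))))
                                             (suc (pair (encode (literal t)) 0)))))

  encode-query : ∀ c ℓ t → encode (query c ℓ t) ≡ question (encode c) ℓ t
  encode-query c ℓ t = refl

  -- The program asked about sits inside `d`. Hence if `e` encodes no unary program, every question
  -- about it has a negative answer.
  question-encodes : ∀ (d : Code 1) e ℓ t → encode d ≡ question e ℓ t →
                     ∃ λ (c : Code 1) → encode c ≡ e
  question-encodes d e ℓ t eq
    with _ , _ , g , _ , _ , g≡ , _ ←
      encode-comp⁻¹ d (encode exceeds) (pair 3 (pair e (suc (pair (encode (literal ℓ)) 0)))) _ eq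
    with encode-comp⁻¹ g e (encode (literal ℓ)) 0 g≡
  ... | _ , f , _ , [] , f≡e , _ = f , f≡e

  questionP : {f g h : Vec ℕ n → ℕ} → Program O f → Program O g → Program O h →
              Program O (λ xs → question (f xs) (g xs) (h xs))
  questionP p q r =
    pairP (lit 3) (pairP (lit (encode exceeds)) (sucP (pairP
      (pairP (lit 3) (pairP p (sucP (pairP (literalP q) (lit 0)))))
      (sucP (pairP (literalP r) (lit 0))))))

question-yes : ∀ c {ℓ t w} → ∅ ⊢ c · [ ℓ ] ↓ w → t < w → question (encode c) ℓ t ∈ ∅′
question-yes c {ℓ} {t} p t<w = query c ℓ t , encode-query c ℓ t , 0 , query-halts p t<w

question-yes⁻¹ : ∀ c {ℓ t} → question (encode c) ℓ t ∈ ∅′ → ∃ λ w → ∅ ⊢ c · [ ℓ ] ↓ w × t < w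
question-yes⁻¹ c {ℓ} {t} (d , eq , y , run) = query-halts⁻¹ {c} (subst (λ d → ∅ ⊢ d · _ ↓ y) d≡query run)
  where
  d≡query : d ≡ query c ℓ t
  d≡query = encode-injective d (query c ℓ t) (trans eq (sym (encode-query c ℓ t)))

question-no : ∀ c {ℓ t w} → ∅ ⊢ c · [ ℓ ] ↓ w → w ≤ t → question (encode c) ℓ t ∉ ∅′
question-no c p w≤t q∈ with _ , p′ , t<w ← question-yes⁻¹ c q∈
  with refl ← deterministic p p′ = <⇒≱ t<w w≤t

-- Genericity and nonrecursiveness.

indicator : ∀ {P : Set} → Dec P → ℕ
indicator (yes _) = 1
indicator (no  _) = 0

indicator-χ : ∀ {A} (A? : ∀ x → Dec (x ∈ A)) x → χ A x (indicator (A? x))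
indicator-χ A? x with A? x
... | yes x∈A = inj₁ (x∈A , refl)
... | no  x∉A = inj₂ (x∉A , refl)

-- All irreducibility results rest on this property. Since `ℓ` cannot be chosen, `u` has to do its
-- work at every `ℓ`.
Generic : Pred ℕ 0ℓ → Set
Generic A = ∀ {u} → Program₁ ∅ u →
            ∃ λ ℓ → ℓ + u ℓ ∈ A × (∀ {x} → ℓ ≤ x → x < ℓ + u ℓ → x ∉ A)

-- For the characteristic function u of A, that block gives ℓ ∈ A if u ℓ = 0 and ℓ ∉ A if u ℓ = 1.
generic⇒nonrecursive : ∀ {A} → (∀ x → Dec (x ∈ A)) → Generic A → ¬ Recursive A
generic⇒nonrecursive {A} A? generic (c , c-correct)
  with ℓ , last∈A , others∉A ← generic (program c λ { (x ∷ []) → c-correct x _ (indicator-χ A? x) })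
  with A? ℓ
... | yes ℓ∈A = others∉A ≤-refl (m<m+n ℓ z<s) ℓ∈A
... | no  ℓ∉A = ℓ∉A (subst (_∈ A) (+-identityʳ ℓ) last∈A)

-- A generic set computable from `∅′`.

module GenericSet (em : ExcludedMiddle 0ℓ) where

  ∅′? : ∀ x → Dec (x ∈ ∅′)
  ∅′? x = em

  answer : ℕ → ℕ → ℕ → ℕ
  answer e ℓ t = indicator (∅′? (question e ℓ t))

  answer-zero : ∀ {e ℓ t} → question e ℓ t ∉ ∅′ → answer e ℓ t ≡ 0
  answer-zero {e} {ℓ} {t} q∉ with ∅′? (question e ℓ t)
  ... | yes q∈ = contradiction q∈ q∉
  ... | no  _  = refl

  answer-nonzero : ∀ {e ℓ t} → question e ℓ t ∈ ∅′ → answer e ℓ t ≢ 0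
  answer-nonzero {e} {ℓ} {t} q∈ with ∅′? (question e ℓ t)
  ... | yes _  = λ ()
  ... | no  q∉ = contradiction q∈ q∉

  answered : ∀ e ℓ → ∃ λ t → answer e ℓ t ≡ 0
  answered e ℓ with ∅′? (question e ℓ 0)
  ... | no q∉ = 0 , answer-zero q∉
  -- A positive answer at 0 shows that `e` encodes a program halting on `ℓ`; its output bounds the
  -- search.
  ... | yes q∈@(d , eq , _) with c , refl ← question-encodes d e ℓ 0 eq
    with w , p , _ ← question-yes⁻¹ c q∈ = w , answer-zero (question-no c p ≤-refl)

  -- φₑ(ℓ) if this is defined, and 0 otherwise.
  value : ℕ → ℕ → ℕ
  value e ℓ = μ (answer e ℓ) (answered e ℓ)

  value-correct : ∀ c {ℓ w} → ∅ ⊢ c · [ ℓ ] ↓ w → value (encode c) ℓ ≡ w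
  value-correct c {ℓ} {w} p = ≤-antisym
    (≮⇒≥ λ w<v → μ-least _ (answered (encode c) ℓ) w<v (answer-zero (question-no c p ≤-refl)))
    (≮⇒≥ λ v<w → answer-nonzero (question-yes c p v<w) (μ-zero _ (answered (encode c) ℓ)))

  stage : ℕ → ℕ
  stage zero    = 0
  stage (suc e) = suc (stage e + value e (stage e))

  open Blocks stage refl (λ e → s≤s (m≤m+n _ _))

  -- The last elements of the blocks [stage e , stage (suc e)).
  A : Pred ℕ 0ℓ
  A x = suc x ≡ stage (suc (index x))

  A-generic : Generic A
  A-generic {u} p = ℓ , trans last≡ (cong (stage ∘ suc) (sym (in-block (m≤m+n ℓ (u ℓ)) ≤-refl))) ,
    λ ℓ≤x x<last x∈A → <⇒≢ x<last (suc-injective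
      (trans x∈A (trans (cong (stage ∘ suc) (in-block ℓ≤x (<⇒≤ x<last))) (sym last≡))))
    where
    -- The block whose index is the number of a program for `u` has exactly `u ℓ + 1` elements.
    e = encode (code p)
    ℓ = stage e
    last≡ : suc (ℓ + u ℓ) ≡ stage (suc e)
    last≡ = cong (λ v → suc (ℓ + v)) (sym (value-correct (code p) (halts p [ ℓ ])))
    in-block : ∀ {x} → ℓ ≤ x → x ≤ ℓ + u ℓ → index x ≡ e
    in-block ℓ≤x x≤last = index-unique ℓ≤x (≤-trans (s≤s x≤last) (≤-reflexive last≡))

  answerP : {f g h : Vec ℕ n → ℕ} → Program ∅′ f → Program ∅′ g → Program ∅′ h →
            Program ∅′ (λ xs → answer (f xs) (g xs) (h xs))
  answerP p q r = app₁ oracleP (questionP p q r)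
    where
    oracleP : Program₁ ∅′ (indicator ∘ ∅′?)
    oracleP = program oracle λ { (x ∷ []) → oracle (indicator-χ ∅′? x) }

  valueP : {f g : Vec ℕ n → ℕ} → Program ∅′ f → Program ∅′ g →
           Program ∅′ (λ xs → value (f xs) (g xs))
  valueP = app₂ value₂
    where
    value₂ : Program ∅′ {2} (λ xs → value (lookup xs 0F) (lookup xs 1F))
    value₂ = minimise (answerP (arg 1F) (arg 2F) (arg 0F)) (λ { (e ∷ ℓ ∷ []) → answered e ℓ })
             by λ { (e ∷ ℓ ∷ []) → refl }

  stageP : Program₁ ∅′ stage
  stageP = primrec (λ k _ → stage k) (lit 0) (sucP (arg 1F +P valueP (arg 0F) (arg 1F)))
                   (λ _ → refl) (λ _ _ → refl)

  A≤T∅′ : A ≤T ∅′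
  A≤T∅′ = code A-program , λ x b χb →
    subst (∅′ ⊢ code A-program · [ x ] ↓_) (value-χ x b χb) (halts A-program [ x ])
    where
    -- `suc x` is at most the first element of the next block, so the inner difference vanishes
    -- exactly for `x` in `A`.
    A-program : Program₁ ∅′ (λ x → 1 ∸ (stage (suc (index x)) ∸ suc x))
    A-program = lit 1 ∸P (app₁ stageP (sucP (indexP stageP (arg 0F))) ∸P sucP (arg 0F))
      by λ { (x ∷ []) → refl }
    value-χ : ∀ x b → χ A x b → 1 ∸ (stage (suc (index x)) ∸ suc x) ≡ b
    value-χ x _ (inj₁ (x∈A , refl)) = cong (1 ∸_) (m≤n⇒m∸n≡0 (≤-reflexive (sym x∈A)))
    value-χ x _ (inj₂ (x∉A , refl)) = m≤n⇒m∸n≡0 (m<n⇒0<n∸m (≤∧≢⇒< (index-upper x) x∉A))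

-- Doubling the elements of a decidable set

-- n occupies a block of two numbers if T n = 0, and of one number otherwise.
starts : (ℕ → ℕ) → ℕ → ℕ
starts T zero    = 0
starts T (suc n) = suc (1 ∸ T n) + starts T n

module Doubling (T : ℕ → ℕ) = Blocks (starts T) refl (λ n → s≤s (m≤n+m _ _))

Doubled : Pred ℕ 0ℓ → (ℕ → ℕ) → Pred ℕ 0ℓ
Doubled A T x = Doubling.index T x ∈ A

startsP : ∀ {T} → Program₁ O T → Program₁ O (starts T)
startsP {T = T} p = primrec (λ k _ → starts T k) (lit 0)
  (sucP (lit 1 ∸P app₁ p (arg 0F)) +P arg 1F) (λ _ → refl) (λ _ _ → refl)

module _ (T : ℕ → ℕ) where
  open Doubling T

  offset-< : ∀ x → offset x < suc (1 ∸ T (index x))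
  offset-< x = +-cancelˡ-< (starts T (index x)) _ _ (begin-strict
    starts T (index x) + offset x                 ≡⟨ L+offset x ⟩
    x                                             <⟨ index-upper x ⟩
    suc (1 ∸ T (index x)) + starts T (index x)    ≡⟨ +-comm (suc (1 ∸ T (index x))) _ ⟩
    starts T (index x) + suc (1 ∸ T (index x))    ∎)
    where open ≤-Reasoning

  index-offset-injective : ∀ {x y} → index x ≡ index y → offset x ≡ offset y → x ≡ y
  index-offset-injective {x} {y} i≡ o≡ =
    trans (sym (L+offset x)) (trans (cong₂ (λ i o → starts T i + o) i≡ o≡) (L+offset y))

  -- Blocks at nonzero values of `T` are singletons, so both offsets are 0.
  index-injective-at : ∀ {x y} → T (index x) ≢ 0 → index x ≡ index y → x ≡ y
  index-injective-at {x} {y} T≢0 i≡ = index-offset-injective i≡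
    (trans (offset≡0 x T≢0) (sym (offset≡0 y (λ T≡0 → T≢0 (trans (cong T i≡) T≡0)))))
    where
    offset≡0 : ∀ z → T (index z) ≢ 0 → offset z ≡ 0
    offset≡0 z T≢0 = n<1⇒n≡0 (<-≤-trans (offset-< z)
      (s≤s (≤-reflexive (m≤n⇒m∸n≡0 (n≢0⇒n>0 T≢0)))))

  -- The collapse of the blocks has fibres of at most two elements, told apart by their offsets, and
  -- `starts T` is an injective section of it.
  Doubled≡bfo : ∀ {A} → Program₁ ∅ T → Doubled A T ≡bfo A
  Doubled≡bfo {A} p =
    ( index , 2 , toComputable (indexP (startsP p) argument) , s≤s z≤n
    , (λ x → ⇔-id _)
    , λ y → mk↣ {to = λ (x , _) → fromℕ< (offset<2 x)} λ { {x , refl} {x′ , i≡} eq →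
        fibre-≡ (sym i≡) (fromℕ<-injective _ _ (offset<2 x) (offset<2 x′) eq) } )
    ,
    ( starts T , 1 , toComputable (startsP p) , ≤-refl
    , (λ x → mk⇔ (subst (_∈ A) (sym (index-L x))) (subst (_∈ A) (index-L x)))
    , λ y → mk↣ {to = λ _ → 0F} λ { {x , refl} {x′ , eq} _ → Σ-≡ (L-injective (sym eq)) } )
    where
    offset<2 : ∀ x → offset x < 2
    offset<2 x = <-≤-trans (offset-< x) (s≤s (m∸n≤m 1 (T (index x))))
    Σ-≡ : ∀ {f : ℕ → ℕ} {y} {u v : ∃ λ x → f x ≡ y} → proj₁ u ≡ proj₁ v → u ≡ v
    Σ-≡ {u = _ , p} {v = _ , q} refl = cong (_ ,_) (≡-irrelevant p q)
    fibre-≡ : ∀ {y} {u v : ∃ λ x → index x ≡ y} → index (proj₁ u) ≡ index (proj₁ v) →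
              offset (proj₁ u) ≡ offset (proj₁ v) → u ≡ v
    fibre-≡ i≡ o≡ = Σ-≡ (index-offset-injective i≡ o≡)

-- Reductions between doubled sets.

unbounded : ∀ {z} → Injective _≡_ _≡_ z → ∀ N → ∃ λ i → N ≤ z i
unbounded {z} z-inj N with any? {n = suc N} (λ i → N ≤? z (toℕ i))
... | yes (i , N≤z) = toℕ i , N≤z
-- Otherwise `N + 1` values below `N` would be distinct.
... | no  N≰z with i , j , i<j , eq ← pigeonhole (n<1+n N) (λ i → fromℕ< (≰⇒> (λ N≤z → N≰z (i , N≤z))))
  = contradiction (z-inj (fromℕ<-injective _ _ _ _ eq)) (<⇒≢ i<j)

∸+∸≡0⇒≡ : ∀ m n → (m ∸ n) + (n ∸ m) ≡ 0 → m ≡ n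
∸+∸≡0⇒≡ m n eq = ≤-antisym (m∸n≡0⇒m≤n (m+n≡0⇒m≡0 (m ∸ n) eq)) (m∸n≡0⇒m≤n (m+n≡0⇒n≡0 (m ∸ n) eq))

≡⇒∸+∸≡0 : m ≡ n → (m ∸ n) + (n ∸ m) ≡ 0
≡⇒∸+∸≡0 {m} refl = cong₂ _+_ (n∸n≡0 m) (n∸n≡0 m)

-- Since `m ∸ n + n` is the maximum of `m` and `n`, `last` is the larger of the two, and the smaller
-- lies in the part of the interval that avoids `A`.
separated : ∀ {A : Pred ℕ 0ℓ} {ℓ m n} → ℓ ≤ m → ℓ ≤ n → m ≢ n → m ∈ A ⇔ n ∈ A →
            let last = ℓ + ((m ∸ n + n) ∸ ℓ) in
            last ∈ A → (∀ {x} → ℓ ≤ x → x < last → x ∉ A) → ⊥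
separated {A} {ℓ} {m} {n} ℓ≤m ℓ≤n m≢n m∈A⇔n∈A last∈A others∉A with <-cmp m n
... | tri< m<n _ _ = others∉A ℓ≤m (<-≤-trans m<n (≤-reflexive (sym last≡n)))
                       (Equivalence.from m∈A⇔n∈A (subst (_∈ A) last≡n last∈A))
  where
  last≡n : ℓ + ((m ∸ n + n) ∸ ℓ) ≡ n
  last≡n = trans (cong (λ d → ℓ + ((d + n) ∸ ℓ)) (m≤n⇒m∸n≡0 (<⇒≤ m<n))) (m+[n∸m]≡n ℓ≤n)
... | tri≈ _ m≡n _ = m≢n m≡n
... | tri> _ _ n<m = others∉A ℓ≤n (<-≤-trans n<m (≤-reflexive (sym last≡m)))
                       (Equivalence.to m∈A⇔n∈A (subst (_∈ A) last≡m last∈A))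
  where
  last≡m : ℓ + ((m ∸ n + n) ∸ ℓ) ≡ m
  last≡m = trans (cong (λ k → ℓ + (k ∸ ℓ)) (m∸n+n≡m (<⇒≤ n<m))) (m+[n∸m]≡n ℓ≤m)

-- A search at ℓ yields y for which g y and h y are distinct and at least ℓ. For u ℓ leading to
-- the larger of the two, genericity puts it into A and keeps the smaller one out.
generic-separates : ∀ {A g h} → Generic A → Program₁ ∅ g → Program₁ ∅ h →
                    (∀ ℓ → ∃ λ y → ℓ ≤ g y × ℓ ≤ h y × g y ≢ h y) →
                    ¬ (∀ y → g y ∈ A ⇔ h y ∈ A)
generic-separates {A} {g} {h} generic gP hP found g⇔h =
  let ℓ , last∈A , others∉A = generic {u} uP
      ℓ≤g , ℓ≤h , g≢h       = test-zero⁻¹ {search ℓ} {ℓ} (μ-zero (λ y → test y ℓ) (tested ℓ))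
  in separated {A} ℓ≤g ℓ≤h g≢h (g⇔h (search ℓ)) last∈A others∉A
  where
  -- Zero exactly when g y and h y are distinct and at least ℓ.
  test : ℕ → ℕ → ℕ
  test y ℓ = (ℓ ∸ g y) + (ℓ ∸ h y) + (1 ∸ ((g y ∸ h y) + (h y ∸ g y)))

  test-zero⁻¹ : ∀ {y ℓ} → test y ℓ ≡ 0 → ℓ ≤ g y × ℓ ≤ h y × g y ≢ h y
  test-zero⁻¹ {y} {ℓ} eq =
    m∸n≡0⇒m≤n (m+n≡0⇒m≡0 (ℓ ∸ g y) bounds) ,
    m∸n≡0⇒m≤n (m+n≡0⇒n≡0 (ℓ ∸ g y) bounds) ,
    λ g≡h → 1+n≢0 (trans (sym (cong (1 ∸_) (≡⇒∸+∸≡0 g≡h))) (m+n≡0⇒n≡0 _ eq))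
    where
    bounds : (ℓ ∸ g y) + (ℓ ∸ h y) ≡ 0
    bounds = m+n≡0⇒m≡0 _ eq

  tested : ∀ ℓ → ∃ λ y → test y ℓ ≡ 0
  tested ℓ = let y , ℓ≤g , ℓ≤h , g≢h = found ℓ in y , cong₂ _+_
    (cong₂ _+_ (m≤n⇒m∸n≡0 ℓ≤g) (m≤n⇒m∸n≡0 ℓ≤h))
    (m≤n⇒m∸n≡0 (n≢0⇒n>0 (g≢h ∘ ∸+∸≡0⇒≡ _ _)))

  search u : ℕ → ℕ
  search ℓ = μ (λ y → test y ℓ) (tested ℓ)
  u ℓ = (g (search ℓ) ∸ h (search ℓ) + h (search ℓ)) ∸ ℓ

  uP : Program₁ ∅ u
  uP = (app₁ gP searchP ∸P app₁ hP searchP +P app₁ hP searchP) ∸P argument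
    where
    testP : Program ∅ {2} (λ xs → test (lookup xs 0F) (lookup xs 1F))
    testP = (arg 1F ∸P app₁ gP (arg 0F)) +P (arg 1F ∸P app₁ hP (arg 0F)) +P
            (lit 1 ∸P ((app₁ gP (arg 0F) ∸P app₁ hP (arg 0F)) +P
                       (app₁ hP (arg 0F) ∸P app₁ gP (arg 0F))))
    searchP : Program₁ ∅ search
    searchP = minimise testP (λ { (ℓ ∷ []) → tested ℓ }) by λ { (ℓ ∷ []) → refl }

module _ {T T′ : ℕ → ℕ} (p : Program₁ ∅ T) (p′ : Program₁ ∅ T′) where
  private
    module D  = Doubling T
    module D′ = Doubling T′

  -- A block of the first partition is at most as long as the block of the same index in the second,
  -- so it can be mapped into it with offsets kept.
  Doubled-mono : ∀ A → (∀ n → T n ≡ 0 → T′ n ≡ 0) → Doubled A T ≤₁ Doubled A T′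
  Doubled-mono A T⊆T′ = f , toComputable fP , f-injective ,
    λ x → mk⇔ (subst (_∈ A) (sym (index-f x))) (subst (_∈ A) (index-f x))
    where
    f : ℕ → ℕ
    f x = starts T′ (D.index x) + D.offset x
    fP : Program₁ ∅ f
    fP = app₁ (startsP p′) (D.indexP (startsP p) argument) +P D.offsetP (startsP p) argument
    size-≤ : ∀ n → 1 ∸ T n ≤ 1 ∸ T′ n
    size-≤ n with T n | T⊆T′ n
    ... | zero  | T≡0⇒T′≡0 rewrite T≡0⇒T′≡0 refl = ≤-refl
    ... | suc k | _ rewrite 0∸n≡0 k = z≤n
    index-f : ∀ x → D′.index (f x) ≡ D.index x
    index-f x = D′.index-unique (m≤m+n _ _) (begin-strict
      starts T′ (D.index x) + D.offset x               <⟨ +-monoʳ-< _ (offset-< T x) ⟩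
      starts T′ (D.index x) + suc (1 ∸ T (D.index x))  ≤⟨ +-monoʳ-≤ _ (s≤s (size-≤ (D.index x))) ⟩
      starts T′ (D.index x) + suc (1 ∸ T′ (D.index x)) ≡⟨ +-comm (starts T′ (D.index x)) _ ⟩
      starts T′ (suc (D.index x))                      ∎)
      where open ≤-Reasoning
    f-injective : Injective _≡_ _≡_ f
    f-injective {x} {y} eq = index-offset-injective T i≡
      (+-cancelˡ-≡ (starts T′ (D.index x)) _ _
        (trans eq (cong (λ i → starts T′ i + D.offset y) (sym i≡))))
      where
      i≡ : D.index x ≡ D.index y
      i≡ = trans (sym (index-f x)) (trans (cong D′.index eq) (index-f y))

  -- The block of index `a i` has two elements for `T` but only one for `T′`, so an injective `f`
  -- moves one of them to a block of another index. This happens for infinitely many `i`, so the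
  -- indices before and after `f` disagree arbitrarily far out, against genericity.
  Doubled-≰ : ∀ {A} → Generic A →
              (a : ℕ → ℕ) → Injective _≡_ _≡_ a → (∀ i → i ≤ a i) →
              (∀ i → T (a i) ≡ 0) → (∀ i → T′ (a i) ≢ 0) →
              ¬ (Doubled A T ≤₁ Doubled A T′)
  Doubled-≰ {A} generic a a-inj i≤a Ta≡0 T′a≢0 (f , f-comp , f-inj , f-red) =
    generic-separates generic (D.indexP (startsP p) argument)
      (D′.indexP (startsP p′) (app₁ (fromComputable f-comp) argument)) found f-red
    where
    g h : ℕ → ℕ
    g = D.index
    h = D′.index ∘ f

    moved : ∀ i → ∃ λ y → g y ≡ a i × h y ≢ a i
    moved i with h (starts T (a i)) ≟ a i
    ... | no  h≢ = starts T (a i) , D.index-L (a i) , h≢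
    ... | yes h≡ = suc (starts T (a i)) , D.index-unique (n≤1+n _) upper , λ h≡′ →
      1+n≢n (sym (f-inj (index-injective-at T′ (λ eq → T′a≢0 i (trans (cong T′ (sym h≡)) eq))
                                                (trans h≡ (sym h≡′)))))
      where
      upper : suc (starts T (a i)) < starts T (suc (a i))
      upper rewrite Ta≡0 i = ≤-refl

    found : ∀ ℓ → ∃ λ y → ℓ ≤ g y × ℓ ≤ h y × g y ≢ h y
    -- Starting from `a ℓ` keeps `g` at least `ℓ`. The chosen points lie in distinct blocks, so
    -- their images under `f` are unbounded and one reaches `starts T′ ℓ`, from where on the index
    -- is at least `ℓ`.
    found ℓ = let i , bound = unbounded {f ∘ y} z-inj (starts T′ ℓ) in y i ,
      ≤-trans (≤-trans (m≤m+n ℓ i) (i≤a (ℓ + i))) (≤-reflexive (sym (g-y i))) ,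
      ≮⇒≥ (λ h<ℓ → <⇒≱ (D′.index-<⇒<L {f (y i)} h<ℓ) bound) ,
      λ g≡h → proj₂ (proj₂ (moved (ℓ + i))) (trans (sym g≡h) (g-y i))
      where
      y : ℕ → ℕ
      y i = proj₁ (moved (ℓ + i))
      g-y : ∀ i → g (y i) ≡ a (ℓ + i)
      g-y i = proj₁ (proj₂ (moved (ℓ + i)))
      z-inj : Injective _≡_ _≡_ (f ∘ y)
      z-inj {i} {j} eq = +-cancelˡ-≡ ℓ i j
        (a-inj (trans (sym (g-y i)) (trans (cong g (f-inj eq)) (g-y j))))

-- Two families of decidable sets

-- The blocks are the antidiagonals of Cantor's pairing, so `row` and `col` decode `pair`.
module Rows = Blocks triangle refl (λ n → s≤s (m≤n+m _ n))
open Rows renaming (index to row; offset to col)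

triangle₁ : Program₁ O triangle
triangle₁ = triangleP argument

row-pair : ∀ x y → row (pair x y) ≡ x + y
row-pair x y = Rows.index-unique (m≤m+n _ y)
  (s≤s (≤-trans (≤-reflexive (+-comm (triangle (x + y)) y)) (+-monoˡ-≤ (triangle (x + y)) (m≤n+m y x))))

col-pair : ∀ x y → col (pair x y) ≡ y
col-pair x y = trans (cong (λ r → pair x y ∸ triangle r) (row-pair x y)) (m+n∸m≡n (triangle (x + y)) y)

x≤pair : ∀ x y → x ≤ pair x y
x≤pair x y = ≤-trans (m≤m+n x y) (≤-trans (Rows.n≤L (x + y)) (m≤m+n _ y))

-- This is the distance from `col n` to `i`. The elements doubled are those of the `i`-th column,
-- and distinct columns are disjoint and infinite.
offColumn : ℕ → ℕ → ℕ
offColumn i n = (col n ∸ i) + (i ∸ col n)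

offColumnP : ∀ i → Program₁ O (offColumn i)
offColumnP i = (colP ∸P lit i) +P (lit i ∸P colP)
  where
  colP : Program₁ _ col
  colP = Rows.offsetP triangle₁ argument

offColumn-≰ : ∀ {A m n} → Generic A → m ≢ n →
              ¬ (Doubled A (offColumn m) ≤₁ Doubled A (offColumn n))
offColumn-≰ {m = m} {n} generic m≢n = Doubled-≰ (offColumnP m) (offColumnP n) generic
  (λ i → pair i m) (λ {i} {j} eq → proj₁ (pair-injective i m j m eq)) (λ i → x≤pair i m)
  (λ i → ≡⇒∸+∸≡0 (col-pair i m))
  (λ i eq → m≢n (trans (sym (col-pair i m)) (∸+∸≡0⇒≡ _ n eq)))

-- Inequalities between rationals in terms of natural numbers.

pos neg : ℤ → ℕ
pos (+ n)    = n
pos -[1+ _ ] = 0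
neg (+ _)    = 0
neg -[1+ n ] = suc n

pos-neg : ∀ z → z ℤ.+ + neg z ≡ + pos z
pos-neg (+ n)    = ℤ.+-identityʳ (+ n)
pos-neg -[1+ n ] = ℤ.n⊖n≡0 (suc n)

-- Adding the negative parts to both sides of the inequality of cross products leaves natural
-- numbers only.
<⇒cross-< : ∀ {p q} → p ℚ.< q →
            pos (↥ p) * ↧ₙ q + neg (↥ q) * ↧ₙ p < pos (↥ q) * ↧ₙ p + neg (↥ p) * ↧ₙ q
<⇒cross-< {p} {q} (ℚ.*<* lt) = ℤ.drop‿+<+ (subst₂ ℤ._<_ (lhs≡ (↥ p) (↥ q) (↧ₙ p) (↧ₙ q))
  (trans (cong (λ s → ↥ q ℤ.* ↧ p ℤ.+ s) (ℤ.+-comm (+ neg (↥ p) ℤ.* ↧ q) (+ neg (↥ q) ℤ.* ↧ p)))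
         (lhs≡ (↥ q) (↥ p) (↧ₙ q) (↧ₙ p)))
  (ℤ.+-monoˡ-< (+ neg (↥ p) ℤ.* ↧ q ℤ.+ + neg (↥ q) ℤ.* ↧ p) lt))
  where
  lhs≡ : ∀ a b c d → a ℤ.* + d ℤ.+ (+ neg a ℤ.* + d ℤ.+ + neg b ℤ.* + c) ≡
                     + (pos a * d + neg b * c)
  lhs≡ a b c d = begin
    a ℤ.* + d ℤ.+ (+ neg a ℤ.* + d ℤ.+ + neg b ℤ.* + c)
      ≡⟨ ℤ.+-assoc (a ℤ.* + d) (+ neg a ℤ.* + d) (+ neg b ℤ.* + c) ⟨
    a ℤ.* + d ℤ.+ + neg a ℤ.* + d ℤ.+ + neg b ℤ.* + c
      ≡⟨ cong (ℤ._+ + neg b ℤ.* + c) (ℤ.*-distribʳ-+ (+ d) a (+ neg a)) ⟨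
    (a ℤ.+ + neg a) ℤ.* + d ℤ.+ + neg b ℤ.* + c
      ≡⟨ cong₂ (λ s t → s ℤ.* + d ℤ.+ t) (pos-neg a) (sym (ℤ.pos-* (neg b) c)) ⟩
    + pos a ℤ.* + d ℤ.+ + (neg b * c)
      ≡⟨ cong (ℤ._+ + (neg b * c)) (ℤ.pos-* (pos a) d) ⟨
    + (pos a * d + neg b * c) ∎
    where open ≡-Reasoning

-- u / v − v < q, with both sides moved so that no subtraction occurs. The rational u / v − v
-- takes every rational value infinitely often.
lower upper : ℚ → ℕ → ℕ → ℕ
lower q u v = u * ↧ₙ q + neg (↥ q) * v
upper q u v = pos (↥ q) * v + v * v * ↧ₙ q

-- Transitivity through `p`: the hypothesis adds a comparison of u / v - v with `p` to one of `p`
-- with `q`. Taking their sum lets either of the two be the strict one.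
lower-<-upper : ∀ p q u v →
  lower p u v * ↧ₙ q + (pos (↥ p) * ↧ₙ q + neg (↥ q) * ↧ₙ p) * v <
  upper p u v * ↧ₙ q + (pos (↥ q) * ↧ₙ p + neg (↥ p) * ↧ₙ q) * v →
  lower q u v < upper q u v
lower-<-upper p q u v lt = *-cancelˡ-< (↧ₙ p) _ _ (+-cancelʳ-< common _ _
  (subst₂ _<_ (left (pos (↥ p)) (neg (↥ p)) (neg (↥ q)) (↧ₙ p) (↧ₙ q) u v)
              (right (pos (↥ p)) (neg (↥ p)) (pos (↥ q)) (↧ₙ p) (↧ₙ q) v) lt))
  where
  common : ℕ
  common = (pos (↥ p) + neg (↥ p)) * ↧ₙ q * v
  left : ∀ p⁺ p⁻ q⁻ c d u v → (u * c + p⁻ * v) * d + (p⁺ * d + q⁻ * c) * v ≡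
                              c * (u * d + q⁻ * v) + (p⁺ + p⁻) * d * v
  left = solve-∀
  right : ∀ p⁺ p⁻ q⁺ c d v → (p⁺ * v + v * v * c) * d + (q⁺ * c + p⁻ * d) * v ≡
                             c * (q⁺ * v + v * v * d) + (p⁺ + p⁻) * d * v
  right = solve-∀

-- Zero exactly when u / v - v < `q` for v = `suc x`; the shift keeps the denominator positive.
belowIn : ℚ → ℕ → ℕ → ℕ
belowIn q u x = suc (lower q u (suc x)) ∸ upper q u (suc x)

below : ℚ → ℕ → ℕ
below q n = belowIn q (col n) (row n ∸ col n)

below-pair : ∀ q x u → below q (pair x u) ≡ belowIn q u x
below-pair q x u = cong₂ (belowIn q) (col-pair x u)
  (trans (cong₂ _∸_ (row-pair x u) (col-pair x u)) (m+n∸n≡m x u))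

belowP : ∀ q → Program₁ O (below q)
belowP q = sucP (colP *P lit (↧ₙ q) +P lit (neg (↥ q)) *P vP) ∸P
           (lit (pos (↥ q)) *P vP +P vP *P vP *P lit (↧ₙ q))
  where
  colP : Program₁ _ col
  colP = Rows.offsetP triangle₁ argument
  vP : Program₁ _ (λ n → suc (row n ∸ col n))
  vP = sucP (Rows.indexP triangle₁ argument ∸P colP)

below-mono : ∀ {p q} → p ℚ.< q → ∀ n → below p n ≡ 0 → below q n ≡ 0
below-mono {p} {q} p<q n eq = m≤n⇒m∸n≡0 (lower-<-upper p q (col n) v
  (+-mono-<-≤ (*-monoˡ-< (↧ₙ q) (m∸n≡0⇒m≤n {n = upper p (col n) v} eq)) (*-monoˡ-≤ v (<⇒≤ (<⇒cross-< p<q)))))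
  where
  v : ℕ
  v = suc (row n ∸ col n)

module _ (p : ℚ) where
  private
    c k⁺ k⁻ : ℕ
    c  = ↧ₙ p
    k⁺ = pos (↥ p)
    k⁻ = neg (↥ p)

  -- With v = suc (denom i), a multiple of the denominator, u / v − v is p for u = numer i.
  scale denom numer at : ℕ → ℕ
  scale i = suc (k⁻ + i)
  denom i = ℚ.denominator-1 p + (k⁻ + i) * c
  numer i = scale i * k⁺ + (suc (denom i) * suc (denom i) ∸ scale i * k⁻)
  at i = pair (denom i) (numer i)

  at-injective : Injective _≡_ _≡_ at
  at-injective {i} {j} eq = +-cancelˡ-≡ k⁻ i j (*-cancelʳ-≡ _ _ c (+-cancelˡ-≡ (ℚ.denominator-1 p) _ _
    (proj₁ (pair-injective (denom i) (numer i) (denom j) (numer j) eq))))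

  i≤at : ∀ i → i ≤ at i
  i≤at i = begin
    i                  ≤⟨ m≤n+m i k⁻ ⟩
    k⁻ + i             ≤⟨ m≤m*n (k⁻ + i) c ⟩
    (k⁻ + i) * c       ≤⟨ m≤n+m _ _ ⟩
    denom i            ≤⟨ x≤pair _ _ ⟩
    at i               ∎
    where open ≤-Reasoning

  lower≡upper : ∀ i → lower p (numer i) (suc (denom i)) ≡ upper p (numer i) (suc (denom i))
  lower≡upper i = begin
    -- `suc (denom i)` unfolds to `scale i * c`.
    numer i * c + k⁻ * (scale i * c)                ≡⟨ factor (numer i) c k⁻ (scale i) ⟩
    (numer i + scale i * k⁻) * c                    ≡⟨ cong (_* c) (+-assoc (scale i * k⁺) _ _) ⟩
    (scale i * k⁺ + (v * v ∸ scale i * k⁻ + scale i * k⁻)) * c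
      ≡⟨ cong (λ w → (scale i * k⁺ + w) * c) (m∸n+n≡m bound) ⟩
    (scale i * k⁺ + v * v) * c                      ≡⟨ expand (scale i) k⁺ (v * v) c ⟩
    k⁺ * (scale i * c) + v * v * c                  ∎
    where
    open ≡-Reasoning
    v : ℕ
    v = suc (denom i)
    factor : ∀ u c k m → u * c + k * (m * c) ≡ (u + m * k) * c
    factor = solve-∀
    expand : ∀ m k w c → (m * k + w) * c ≡ k * (m * c) + w * c
    expand = solve-∀
    -- `scale i` exceeds `k⁻`, which makes the truncated subtraction in `numer i` exact.
    bound : scale i * k⁻ ≤ v * v
    bound = *-mono-≤ (m≤m*n (scale i) c) (≤-trans (m≤n⇒m≤1+n (m≤m+n k⁻ i)) (m≤m*n (scale i) c))

  -- At these points u / v - v equals `p`: they avoid the set of `p` but, by the next lemma, belong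
  -- to that of every larger `q`.
  below-at≢0 : ∀ i → below p (at i) ≢ 0
  below-at≢0 i eq = <-irrefl (lower≡upper i)
    (m∸n≡0⇒m≤n (trans (sym (below-pair p (denom i) (numer i))) eq))

  below-at≡0 : ∀ {q} → p ℚ.< q → ∀ i → below q (at i) ≡ 0
  below-at≡0 {q} p<q i = trans (below-pair q (denom i) (numer i)) (m≤n⇒m∸n≡0
    (lower-<-upper p q (numer i) (suc (denom i))
      (+-mono-≤-< (≤-reflexive (cong (_* ↧ₙ q) (lower≡upper i)))
                  (*-monoˡ-< (suc (denom i)) (<⇒cross-< p<q)))))

-- The chain indexed by the rationals.

below-≤ : ∀ A {p q} → p ℚ.≤ q → Doubled A (below p) ≤₁ Doubled A (below q)
below-≤ A {p} {q} p≤q with ℚ.<-cmp p q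
... | tri< p<q _ _  = Doubled-mono (belowP p) (belowP q) A (below-mono p<q)
... | tri≈ _ refl _ = ≤₁-refl _
... | tri> _ _ q<p  = contradiction (ℚ.<-≤-trans q<p p≤q) (ℚ.<-irrefl refl)

below-≰ : ∀ {A p q} → Generic A → p ℚ.< q → ¬ (Doubled A (below q) ≤₁ Doubled A (below p))
below-≰ {p = p} {q} generic p<q = Doubled-≰ (belowP q) (belowP p) generic
  (at p) (at-injective p) (i≤at p) (below-at≡0 p p<q) (below-at≢0 p)

below-≤⁻¹ : ∀ {A p q} → Generic A → Doubled A (below p) ≤₁ Doubled A (below q) → p ℚ.≤ q
below-≤⁻¹ generic Bp≤Bq = ℚ.≮⇒≥ λ q<p → below-≰ generic q<p Bp≤Bq

corollary3p6 : ExcludedMiddle 0ℓ →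
    ∃ λ (A : Pred ℕ 0ℓ) →
    ∃ λ (B : ℚ∩⟨1,2⟩ → Pred ℕ 0ℓ) →
    ∃ λ (W : ℕ → Pred ℕ 0ℓ) →
    ¬ Recursive A
    × A ≤T ∅′
    × (∀ q → B q ≡bfo A)
    × (∀ n → W n ≡bfo A)
    × (∀ p q → proj₁ p ℚ.< proj₁ q → B p <₁ B q)
    × (∀ n m → n ≢ m → ¬ (W n ≤₁ W m))
    × ContainsCopyOf (1-degreesIn A) ℚ-poset
    × HasInfiniteAntichain (1-degreesIn A)
corollary3p6 em =
  A , (λ q → Doubled A (below (proj₁ q))) , (λ n → Doubled A (offColumn n)) ,
  generic⇒nonrecursive (λ _ → em) A-generic ,
  A≤T∅′ ,
  (λ q → Doubled≡bfo (below (proj₁ q)) (belowP (proj₁ q))) ,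
  (λ n → Doubled≡bfo (offColumn n) (offColumnP n)) ,
  (λ p q p<q → below-≤ A (ℚ.<⇒≤ p<q) , below-≰ A-generic p<q) ,
  (λ n m → offColumn-≰ A-generic) ,
  -- The copy of ℚ uses the doubled sets of all rationals, not only of those between 1 and 2.
  ((λ q → Doubled A (below q) , Doubled≡bfo (below q) (belowP q)) , record
    { isOrderHomomorphism = record
      { cong = λ { refl → ≤₁-refl _ , ≤₁-refl _ }
      ; mono = below-≤ A
      }
    ; injective = λ (Bp≤Bq , Bq≤Bp) → ℚ.≤-antisym (below-≤⁻¹ A-generic Bp≤Bq) (below-≤⁻¹ A-generic Bq≤Bp)
    ; cancel    = below-≤⁻¹ A-generic
    }) ,
  ((λ n → Doubled A (offColumn n) , Doubled≡bfo (offColumn n) (offColumnP n)) ,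
   λ m≢n → offColumn-≰ A-generic m≢n , offColumn-≰ A-generic (m≢n ∘ sym))
  where open GenericSet em
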